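{- With $m$ and $L$ constants, the algorithm requires $O(d+\log n)$ time to insert a new data point into the data structure for a dataset $D\subseteq\mathbb{R}^d$ of $n$ points, and $O(\log n)$ time to delete a data point.
   Context: Data structure: given $D=\{p^1,\ldots,p^n\}\subseteq\mathbb{R}^d$ and positive integers $m$ (number of simple indices per composite index) and $L$ (number of composite indices), draw $mL$ independent uniformly random unit vectors $u_{jl}\in\mathbb{R}^d$, $j\in[m]$, $l\in[L]$. For each $j,l$, the simple index $T_{jl}$ is a self-balancing binary search tree or skip list storing the pairs $(\langle p^i,u_{jl}\rangle,i)$, $i\in[n]$, with $\langle p^i,u_{jl}\rangle$ being the key and $i$ the value. Inserting a new data point $p$ means computing $\langle p,u_{jl}\rangle$ for all $j,l$ and inserting the corresponding entry in every $T_{jl}$; deleting a data point means removing its entry from every $T_{jl}$. A search, insertion or deletion in a self-balancing binary search tree or skip list with $n$ entries takes $O(\log n)$ time. -}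

module Defs where

open import Level using (Level; _⊔_) renaming (suc to lsuc)
open import Algebra.Structures using (IsCommutativeRing)
open import Data.Fin.Base using (Fin; zero; suc)
open import Data.List.Base as List using (List; []; _∷_; length)
open import Data.List.Membership.Propositional using (_∈_)
open import Data.List.Relation.Binary.Permutation.Propositional
  using (_↭_; ↭-trans; prep)
open import Data.List.Relation.Binary.Permutation.Propositional.Properties
  using (map⁺)
open import Data.List.Relation.Unary.Linked using (Linked)
open import Data.List.Relation.Unary.Unique.Propositional using (Unique)
open import Data.Nat.Base as ℕ using (ℕ; zero; suc)
open import Data.Nat.Logarithm using (⌊log₂_⌋)
open import Data.Product.Base using (∃-syntax; _×_; _,_; proj₁; proj₂)
open import Data.Vec.Base as Vec using (Vec; []; _∷_; lookup)
open import Data.Vec.Properties using (lookup-zipWith; lookup-map)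
open import Relation.Binary.Core using (Rel)
open import Relation.Binary.Structures using (IsDecTotalOrder)
open import Relation.Binary.PropositionalEquality
  using (_≡_; _≢_; refl; trans; cong; cong₂)

private variable
  a b c t : Level
  A : Set a
  B : Set b
  C : Set c
  m n : ℕ

-- The field of real numbers, axiomatised (up to isomorphism) as a
-- Dedekind-complete ordered field.  The order is decidable because, in the
-- real-RAM model in which running times are measured here, comparing two
-- reals is a primitive operation.

record Reals (a : Level) : Set (lsuc a) where
  infixl 6 _+_
  infixl 7 _*_
  infix  4 _≤_
  field
    ℝ                 : Set a
    _+_ _*_           : ℝ → ℝ → ℝ
    -_                : ℝ → ℝ
    0# 1#             : ℝ
    _≤_               : Rel ℝ a
    isCommutativeRing : IsCommutativeRing _≡_ _+_ _*_ -_ 0# 1#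
    0≢1               : 0# ≢ 1#
    inverse           : ∀ x → x ≢ 0# → ∃[ y ] x * y ≡ 1#
    isDecTotalOrder   : IsDecTotalOrder _≡_ _≤_
    +-monoʳ-≤         : ∀ x {y z} → y ≤ z → x + y ≤ x + z
    *-nonNegative     : ∀ {x y} → 0# ≤ x → 0# ≤ y → 0# ≤ x * y

  UpperBound : (ℝ → Set a) → ℝ → Set a
  UpperBound P s = ∀ x → P x → x ≤ s

  field
    complete : (P : ℝ → Set a) → ∃[ x ] P x → ∃[ s ] UpperBound P s →
               ∃[ s ] UpperBound P s × (∀ s′ → UpperBound P s′ → s ≤ s′)

-- A computation, given by its result and the number of elementary steps
-- it takes.

record Timed (A : Set a) : Set a where
  constructor _after_
  field
    value : A
    time  : ℕ

open Timed public

infixl 1 _>>=_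

return : A → Timed A
return x = x after 0

_>>=_ : Timed A → (A → Timed B) → Timed B
x >>= f = value (f (value x)) after (time x ℕ.+ time (f (value x)))

step : Timed A → Timed A
step x = value x after suc (time x)

-- Loops; every iteration costs one step on top of the cost of its body.

for : Vec A n → (A → Timed B) → Timed (Vec B n)
for []       f = return []
for (x ∷ xs) f = step (f x >>= λ y → for xs f >>= λ ys → return (y ∷ ys))

for₂ : Vec A n → Vec B n → (A → B → Timed C) → Timed (Vec C n)
for₂ []       []       f = return []
for₂ (x ∷ xs) (y ∷ ys) f =
  step (f x y >>= λ z → for₂ xs ys f >>= λ zs → return (z ∷ zs))

lookup-for : ∀ (xs : Vec A n) (f : A → Timed B) i →
             lookup (value (for xs f)) i ≡ value (f (lookup xs i))
lookup-for (x ∷ xs) f zero    = refl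
lookup-for (x ∷ xs) f (suc i) = lookup-for xs f i

lookup-for₂ : ∀ (xs : Vec A n) (ys : Vec B n) (f : A → B → Timed C) i →
              lookup (value (for₂ xs ys f)) i ≡
              value (f (lookup xs i) (lookup ys i))
lookup-for₂ (x ∷ xs) (y ∷ ys) f zero    = refl
lookup-for₂ (x ∷ xs) (y ∷ ys) f (suc i) = lookup-for₂ xs ys f i

for-map : ∀ (xs : Vec A n) (f : A → Timed B) (g : A → B) →
          (∀ x → value (f x) ≡ g x) → value (for xs f) ≡ Vec.map g xs
for-map []       f g f≗g = refl
for-map (x ∷ xs) f g f≗g = cong₂ _∷_ (f≗g x) (for-map xs f g f≗g)

-- m × L arrays: position (j , l) belongs to simple index j of composite
-- index l.

Array : Set a → ℕ → ℕ → Set a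
Array A m L = Vec (Vec A L) m

at : ∀ {m L} → Array A m L → Fin m → Fin L → A
at xs j l = lookup (lookup xs j) l

module _ (R : Reals a) where

  open Reals R

  -- An entry is a pair of a key and a value, the value being the label of
  -- a data point.

  Entry : Set a
  Entry = ℝ × ℕ

  -- The interface common to self-balancing search trees and skip lists.
  -- Equal keys are allowed, since distinct data points may have the same
  -- projection.

  record SimpleIndex (t : Level) : Set (a ⊔ lsuc t) where
    field
      Tree        : Set t
      entries     : Tree → List Entry
      sorted      : ∀ T → Linked (λ e e′ → proj₁ e ≤ proj₁ e′) (entries T)
      empty       : Tree
      insert      : Entry → Tree → Timed Tree
      delete      : Entry → Tree → Timed Tree
      empty-spec  : entries empty ≡ []
      insert-spec : ∀ e T → entries (value (insert e T)) ↭ e ∷ entries T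
      delete-spec : ∀ e T es → entries T ↭ e ∷ es →
                    entries (value (delete e T)) ↭ es

    size : Tree → ℕ
    size T = length (entries T)

  -- Insertion and deletion take O(log n) time on an index with n entries.

  record LogarithmicTime (I : SimpleIndex t) : Set (a ⊔ t) where
    open SimpleIndex I
    field
      insert-time : ∃[ c ] ∃[ N ] ∀ e T → N ℕ.≤ size T →
                    time (insert e T) ℕ.≤ c ℕ.* ⌊log₂ size T ⌋
      delete-time : ∃[ c ] ∃[ N ] ∀ e T → e ∈ entries T → N ℕ.≤ size T →
                    time (delete e T) ℕ.≤ c ℕ.* ⌊log₂ size T ⌋

  Point : ℕ → Set a
  Point d = Vec ℝ d

  ⟨_,_⟩ : ∀ {d} → Point d → Point d → ℝ
  ⟨ [] , [] ⟩         = 0#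
  ⟨ x ∷ xs , y ∷ ys ⟩ = x * y + ⟨ xs , ys ⟩

  IsUnit : ∀ {d} → Point d → Set a
  IsUnit u = ⟨ u , u ⟩ ≡ 1#

  -- Each field operation is one elementary step.

  mul add : ℝ → ℝ → Timed ℝ
  mul x y = (x * y) after 1
  add x y = (x + y) after 1

  inner : ∀ {d} → Point d → Point d → Timed ℝ
  inner []       []       = return 0#
  inner (x ∷ xs) (y ∷ ys) =
    step (mul x y >>= λ z → inner xs ys >>= λ s → add z s)

  inner-value : ∀ {d} (p u : Point d) → value (inner p u) ≡ ⟨ p , u ⟩
  inner-value []       []       = refl
  inner-value (x ∷ xs) (y ∷ ys) = cong (x * y +_) (inner-value xs ys)

  -- A dataset is a finite family of points.  The labels are arbitrary
  -- distinct naturals rather than 1 , … , n, so that the remaining points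
  -- keep their labels when a point is deleted.

  LabelledPoint : ℕ → Set a
  LabelledPoint d = ℕ × Point d

  labels : ∀ {d} → List (LabelledPoint d) → List ℕ
  labels = List.map proj₁

  record Dataset (d n : ℕ) : Set a where
    field
      points   : List (LabelledPoint d)
      card     : length points ≡ n
      distinct : Unique (labels points)

  open Dataset public

  Directions : ℕ → ℕ → ℕ → Set a
  Directions m L d = Array (Point d) m L

  -- The real keys ⟨ p , u_jl ⟩ of one data point p.

  Keys : ℕ → ℕ → Set a
  Keys m L = Array ℝ m L

  keys : ∀ {m L d} → Directions m L d → Point d → Keys m L
  keys u p = Vec.map (Vec.map ⟨ p ,_⟩) u

  keys-lookup : ∀ {m L d} (u : Directions m L d) p j l →
                at (keys u p) j l ≡ ⟨ p , at u j l ⟩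
  keys-lookup u p j l =
    trans (cong (λ v → lookup v l) (lookup-map j (Vec.map ⟨ p ,_⟩) u))
          (lookup-map l ⟨ p ,_⟩ (lookup u j))

  computeKeys : ∀ {m L d} → Directions m L d → Point d → Timed (Keys m L)
  computeKeys u p = for u λ us → for us λ v → inner p v

  computeKeys-value : ∀ {m L d} (u : Directions m L d) p →
                      value (computeKeys u p) ≡ keys u p
  computeKeys-value u p =
    for-map u _ _ λ us → for-map us _ _ (inner-value p)

  module _ (I : SimpleIndex t) where

    open SimpleIndex I

    Structure : ℕ → ℕ → Set t
    Structure m L = Array Tree m L

    entryOf : ∀ {d} → Point d → LabelledPoint d → Entry
    entryOf v (i , p) = ⟨ p , v ⟩ , i

    Stores : ∀ {m L d} → Directions m L d → List (LabelledPoint d) →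
             Structure m L → Set a
    Stores u D S = ∀ j l →
      entries (at S j l) ↭ List.map (entryOf (at u j l)) D

    -- Insertion also returns the keys it has computed: together with the
    -- label they are the entries which a later deletion has to remove.

    insertPoint : ∀ {m L d} → Directions m L d → LabelledPoint d →
                  Structure m L → Timed (Keys m L × Structure m L)
    insertPoint u (i , p) S =
      computeKeys u p >>= λ ks →
      (for₂ ks S λ ks′ Ts → for₂ ks′ Ts λ k T → insert (k , i) T) >>= λ S′ →
      return (ks , S′)

    -- As is usual for dictionaries, the item to be deleted is designated by
    -- its stored entries, not by its coordinates.  Recomputing the keys
    -- from the coordinates would take time proportional to d.

    deletePoint : ∀ {m L} → ℕ → Keys m L → Structure m L →
                  Timed (Structure m L)
    deletePoint i ks S =
      for₂ ks S λ ks′ Ts → for₂ ks′ Ts λ k T → delete (k , i) T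

    private
      entryOf-keys : ∀ {m L d} (u : Directions m L d) i p j l →
                     (at (keys u p) j l , i) ≡ entryOf (at u j l) (i , p)
      entryOf-keys u i p j l = cong (_, i) (keys-lookup u p j l)

      lookup-loop : ∀ {m L} (ks : Keys m L) (S : Structure m L)
                    (f : ℝ → Tree → Timed Tree) j l →
                    at (value (for₂ ks S λ ks′ Ts → for₂ ks′ Ts f)) j l ≡
                    value (f (at ks j l) (at S j l))
      lookup-loop ks S f j l =
        trans (cong (λ v → lookup v l)
                    (lookup-for₂ ks S (λ ks′ Ts → for₂ ks′ Ts f) j))
              (lookup-for₂ (lookup ks j) (lookup S j) f l)

    insertPoint-keys : ∀ {m L d} (u : Directions m L d) i p S →
      proj₁ (value (insertPoint {m} {L} u (i , p) S)) ≡ keys u p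
    insertPoint-keys u i p S = computeKeys-value u p

    insertPoint-stores : ∀ {m L d} (u : Directions m L d) i p D S →
      Stores u D S →
      Stores u ((i , p) ∷ D) (proj₂ (value (insertPoint u (i , p) S)))
    insertPoint-stores u i p D S st j l
      rewrite computeKeys-value u p
            | lookup-loop (keys u p) S (λ k → insert (k , i)) j l
            | entryOf-keys u i p j l
      = ↭-trans (insert-spec _ _) (prep _ (st j l))

    deletePoint-stores : ∀ {m L d} (u : Directions m L d) i p D D′ S →
      Stores u D S → D ↭ (i , p) ∷ D′ →
      Stores u D′ (value (deletePoint i (keys u p) S))
    deletePoint-stores u i p D D′ S st D↭ j l
      rewrite lookup-loop (keys u p) S (λ k → delete (k , i)) j l
            | entryOf-keys u i p j l
      = delete-spec _ _ _
          (↭-trans (st j l) (map⁺ (entryOf (at u j l)) D↭))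

{-# OPTIONS --safe #-}

-- Each inner product costs 3d steps and each of the mL tree operations
-- O(log n), so both running times are constant multiples of d + log n and
-- log n respectively.  For n ≥ 2 the logarithm is at least 1, which lets it
-- absorb the constant overhead of the loops.

module Submission where

open import Defs
open import Level using (Level)
open import Data.Fin.Base using (zero; suc)
open import Data.List.Membership.Propositional using (_∈_; _∉_)
open import Data.List.Membership.Propositional.Properties using (∈-map⁺)
open import Data.List.Properties using (length-map)
open import Data.List.Relation.Binary.Permutation.Propositional using (↭-sym)
open import Data.List.Relation.Binary.Permutation.Propositional.Properties
  using (↭-length; ∈-resp-↭)
open import Data.Nat using (ℕ; suc; _+_; _*_; _≤_; z≤n; NonZero)
open import Data.Nat.Logarithm using (⌊log₂_⌋; ⌊log₂⌋-mono-≤)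
open import Data.Nat.Properties
open import Data.Product using (_×_; _,_; ∃-syntax)
open import Data.Vec.Base using (Vec; []; _∷_; lookup)
open import Relation.Binary.PropositionalEquality
  using (_≡_; refl; sym; trans; cong; subst; module ≡-Reasoning)

private variable
  a b c : Level
  A : Set a
  B : Set b
  C : Set c

-- The unit step of an iteration is charged to `x`, since `1 ≤ x`, which turns `K` into `suc K`. The
-- `+ 0` is the cost of the final `return`.
iteration-cost : ∀ n K {x s t} → 1 ≤ x → s ≤ K * x → t ≤ n * suc K * x →
                 suc (s + (t + 0)) ≤ suc n * suc K * x
iteration-cost n K {x} {s} {t} 1≤x s≤ t≤ = begin
  suc (s + (t + 0))               ≡⟨ cong (λ r → suc (s + r)) (+-identityʳ t) ⟩
  suc s + t                       ≤⟨ +-mono-≤ (+-mono-≤ 1≤x s≤) t≤ ⟩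
  suc K * x + n * suc K * x       ≡⟨ *-distribʳ-+ x (suc K) (n * suc K) ⟨
  suc n * suc K * x               ∎
  where open ≤-Reasoning

for-time : ∀ {n} (xs : Vec A n) (f : A → Timed B) K {x} → 1 ≤ x →
           (∀ y → time (f y) ≤ K * x) → time (for xs f) ≤ n * suc K * x
for-time []       f K 1≤x f≤ = z≤n
for-time {n = suc n} (y ∷ ys) f K 1≤x f≤ =
  iteration-cost n K 1≤x (f≤ y) (for-time ys f K 1≤x f≤)

-- The bound on `f` is required only at paired positions: tree operations are bounded through the
-- size of the trees actually stored and, for deletion, only for entries present in them.
for₂-time : ∀ {n} (xs : Vec A n) (ys : Vec B n) (f : A → B → Timed C) K {x} →
            1 ≤ x → (∀ i → time (f (lookup xs i) (lookup ys i)) ≤ K * x) →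
            time (for₂ xs ys f) ≤ n * suc K * x
for₂-time []       []       f K 1≤x f≤ = z≤n
for₂-time {n = suc n} (y ∷ ys) (z ∷ zs) f K 1≤x f≤ =
  iteration-cost n K 1≤x (f≤ zero) (for₂-time ys zs f K 1≤x λ i → f≤ (suc i))

-- A whole row costs at most `L * suc K * x`, so `L * suc K` takes the role of `K` in the outer
-- loop.
for₂-array-time : ∀ {m L} (xs : Array A m L) (ys : Array B m L)
                  (f : A → B → Timed C) K {x} → 1 ≤ x →
                  (∀ j l → time (f (at xs j l) (at ys j l)) ≤ K * x) →
                  time (for₂ xs ys λ xs′ ys′ → for₂ xs′ ys′ f) ≤
                  m * suc (L * suc K) * x
for₂-array-time {L = L} xs ys f K 1≤x f≤ =
  for₂-time xs ys _ (L * suc K) 1≤x λ j →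
  for₂-time (lookup xs j) (lookup ys j) f K 1≤x (f≤ j)

-- Monotonicity suffices because `⌊log₂ 2 ⌋` computes to `1`.
1≤⌊log₂⌋ : ∀ {n} → 2 ≤ n → 1 ≤ ⌊log₂ n ⌋
1≤⌊log₂⌋ = ⌊log₂⌋-mono-≤

module _ (R : Reals a) where

  -- Each coordinate costs one loop step, one multiplication and one addition.
  inner-time : ∀ {d} (p u : Point R d) → time (inner R p u) ≡ 3 * d
  inner-time []       []       = refl
  inner-time {suc d} (x ∷ p) (y ∷ u) = begin
    2 + (time (inner R p u) + 1)   ≡⟨ cong (2 +_) (+-comm _ 1) ⟩
    3 + time (inner R p u)         ≡⟨ cong (3 +_) (inner-time p u) ⟩
    3 + 3 * d                      ≡⟨ *-suc 3 d ⟨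
    3 * suc d                      ∎
    where open ≡-Reasoning

  computeKeys-time : ∀ {m L d} (u : Directions R m L d) p {x} →
                     1 ≤ x → d ≤ x →
                     time (computeKeys R u p) ≤ m * suc (L * 4) * x
  computeKeys-time {L = L} u p {x} 1≤x d≤x =
    -- The `4` is `suc 3`: three steps per coordinate, with `d ≤ x`, and one for the loop over a
    -- row.
    for-time u _ (L * 4) 1≤x λ us → for-time us _ 3 1≤x λ v →
    ≤-trans (≤-reflexive (inner-time p v)) (*-monoʳ-≤ 3 d≤x)

  module _ (I : SimpleIndex R b) where

    open SimpleIndex I

    -- Permutations preserve length. This turns the logarithm of a tree's size into `⌊log₂ n ⌋`.
    size-stores : ∀ {m L d n} (u : Directions R m L d) (D : Dataset R d n)
                  (S : Structure R I m L) → Stores R I u (points D) S →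
                  ∀ j l → size (at S j l) ≡ n
    size-stores u D S st j l =
      trans (↭-length (st j l)) (trans (length-map _ (points D)) (card D))

    -- Supplies the membership premise of `delete-time`; `keys-lookup` identifies the tabulated key
    -- with the inner product stored in the tree.
    stored-entry : ∀ {m L d} (u : Directions R m L d) D
                   (S : Structure R I m L) → Stores R I u D S →
                   ∀ {i p} → (i , p) ∈ D → ∀ j l →
                   (at (keys R u p) j l , i) ∈ entries (at S j l)
    stored-entry u D S st {i} {p} ip∈D j l =
      subst (λ k → (k , i) ∈ entries (at S j l)) (sym (keys-lookup R u p j l))
            (∈-resp-↭ (↭-sym (st j l)) (∈-map⁺ _ ip∈D))

theorem10 : ∀ {a t : Level} (R : Reals a) (I : SimpleIndex R t) → LogarithmicTime R I →
    ∀ (m L : ℕ) .{{_ : NonZero m}} .{{_ : NonZero L}} →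
    (∃[ C ] ∃[ N ]
    ∀ (d n : ℕ) (u : Directions R m L d) → (∀ j l → IsUnit R (at u j l)) →
    ∀ (D : Dataset R d n) (S : Structure R I m L) → Stores R I u (points D) S →
    ∀ (i : ℕ) (p : Point R d) → i ∉ labels R (points D) →
    N ≤ n → time (insertPoint R I u (i , p) S) ≤ C * (d + ⌊log₂ n ⌋))
    ×
    (∃[ C ] ∃[ N ]
    ∀ (d n : ℕ) (u : Directions R m L d) → (∀ j l → IsUnit R (at u j l)) →
    ∀ (D : Dataset R d n) (S : Structure R I m L) → Stores R I u (points D) S →
    ∀ (i : ℕ) (p : Point R d) → (i , p) ∈ points D →
    N ≤ n → time (deletePoint R I i (keys R u p) S) ≤ C * ⌊log₂ n ⌋)
theorem10 R I log-time m L
  with c , N , insert≤ ← LogarithmicTime.insert-time log-time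
     | c′ , N′ , delete≤ ← LogarithmicTime.delete-time log-time
  -- The two summands pay for the keys and for the tree insertions. A threshold `2 + N` gives both
  -- `2 ≤ n` and `N ≤ n`.
  = (m * suc (L * 4) + m * suc (L * suc c) , 2 + N , insertion)
  , (m * suc (L * suc c′) , 2 + N′ , deletion)
  where
  open SimpleIndex I

  insertion :
    ∀ d n (u : Directions R m L d) → (∀ j l → IsUnit R (at u j l)) →
    ∀ (D : Dataset R d n) S → Stores R I u (points D) S →
    ∀ i p → i ∉ labels R (points D) → 2 + N ≤ n →
    time (insertPoint R I u (i , p) S) ≤
    (m * suc (L * 4) + m * suc (L * suc c)) * (d + ⌊log₂ n ⌋)
  insertion d n u _ D S st i p _ 2+N≤n = begin
    time (computeKeys R u p) + (time loop + 0)
      ≡⟨ cong (time (computeKeys R u p) +_) (+-identityʳ _) ⟩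
    time (computeKeys R u p) + time loop
      ≤⟨ +-mono-≤ (computeKeys-time R u p 1≤x (m≤m+n d _))
                  (for₂-array-time ks S _ c 1≤x insert-at) ⟩
    m * suc (L * 4) * x + m * suc (L * suc c) * x
      ≡⟨ *-distribʳ-+ x (m * suc (L * 4)) _ ⟨
    (m * suc (L * 4) + m * suc (L * suc c)) * x ∎
    where
    open ≤-Reasoning
    -- A common unit for both phases: it dominates `d`, `⌊log₂ n ⌋` and `1`.
    x = d + ⌊log₂ n ⌋
    ks = value (computeKeys R u p)
    loop = for₂ ks S λ ks′ Ts → for₂ ks′ Ts λ k T → insert (k , i) T

    1≤x : 1 ≤ x
    1≤x = ≤-trans (1≤⌊log₂⌋ (m+n≤o⇒m≤o 2 2+N≤n)) (m≤n+m _ d)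

    insert-at : ∀ j l → time (insert (at ks j l , i) (at S j l)) ≤ c * x
    insert-at j l with size-n ← size-stores R I u D S st j l = begin
      time (insert (at ks j l , i) (at S j l))
        ≤⟨ insert≤ _ _ (subst (N ≤_) (sym size-n) (m+n≤o⇒n≤o 2 2+N≤n)) ⟩
      c * ⌊log₂ size (at S j l) ⌋   ≡⟨ cong (λ k → c * ⌊log₂ k ⌋) size-n ⟩
      c * ⌊log₂ n ⌋                 ≤⟨ *-monoʳ-≤ c (m≤n+m _ d) ⟩
      c * x                         ∎

  deletion :
    ∀ d n (u : Directions R m L d) → (∀ j l → IsUnit R (at u j l)) →
    ∀ (D : Dataset R d n) S → Stores R I u (points D) S →
    ∀ i p → (i , p) ∈ points D → 2 + N′ ≤ n →
    time (deletePoint R I i (keys R u p) S) ≤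
    m * suc (L * suc c′) * ⌊log₂ n ⌋
  deletion d n u _ D S st i p ip∈D 2+N′≤n =
    -- The keys are given, so no inner products are paid for and the unit is `⌊log₂ n ⌋` alone.
    for₂-array-time ks S _ c′ (1≤⌊log₂⌋ (m+n≤o⇒m≤o 2 2+N′≤n)) delete-at
    where
    open ≤-Reasoning
    ks = keys R u p

    delete-at : ∀ j l →
                time (delete (at ks j l , i) (at S j l)) ≤ c′ * ⌊log₂ n ⌋
    delete-at j l with size-n ← size-stores R I u D S st j l = begin
      time (delete (at ks j l , i) (at S j l))
        ≤⟨ delete≤ _ _ (stored-entry R I u (points D) S st ip∈D j l)
                   (subst (N′ ≤_) (sym size-n) (m+n≤o⇒n≤o 2 2+N′≤n)) ⟩
      c′ * ⌊log₂ size (at S j l) ⌋  ≡⟨ cong (λ k → c′ * ⌊log₂ k ⌋) size-n ⟩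
      c′ * ⌊log₂ n ⌋                ∎
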